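{- For every integer $n\ge 1$, $|\mathcal{S}_n(23;\,3\to 1)| = C_n$, where $C_n=\frac{1}{n+1}\binom{2n}{n}$ is the $n$-th Catalan number.
   Context: $[n]=\{1,\dots,n\}$, and $\mathcal{S}_n$ is the set of permutations $\pi=\pi_1\pi_2\cdots\pi_n$ of $[n]$ in one-line notation. The permutation $\hat\pi$: for $\pi\in\mathcal{S}_n$, $\hat\pi\in\mathcal{S}_n$ is the permutation whose cycle form is obtained from the word $\pi_1\cdots\pi_n$ by inserting a left parenthesis before each left-to-right maximum (an entry larger than all entries to its left) and a right parenthesis immediately before the next left-to-right maximum, or at the end of the word. A cycle $(c_1,c_2,\dots,c_s)$ means $c_1\mapsto c_2\mapsto\cdots\mapsto c_s\mapsto c_1$. Example: if $\pi=2537164$ then $\hat\pi=(2)(53)(7164)$. Arrow patterns: an arrow pattern of size $k$ is a pair $(\nu;H)$ where $\nu=\nu_1\cdots\nu_m$ is a word of distinct positive integers, $H$ is a collection of arrows $b_i\to c_i$, and the set of all integers appearing in $\nu$ or $H$ is $[k]$. A permutation $\pi\in\mathcal{S}_n$ contains $(\nu;H)$ if there are a set $X=\{x_1<x_2<\cdots<x_k\}\subseteq[n]$ and indices $t_1<\cdots<t_m$ such that $\pi_{t_1}\pi_{t_2}\cdots\pi_{t_m}=x_{\nu_1}x_{\nu_2}\cdots x_{\nu_m}$ and $\hat\pi(x_{b_i})=x_{c_i}$ for every arrow $b_i\to c_i$ in $H$. Otherwise $\pi$ avoids $(\nu;H)$. $\mathcal{S}_n(\nu;H)$ is the set of permutations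 in $\mathcal{S}_n$ avoiding $(\nu;H)$. -}

module Defs where

open import Data.Bool.Base using (if_then_else_)
open import Data.Fin.Base using (Fin; _<_)
open import Data.Fin.Patterns using (0F; 1F; 2F; 3F; 4F; 5F; 6F)
open import Data.Fin.Permutation using (Permutation′; _⟨$⟩ʳ_; _≈_)
open import Data.Fin.Properties using (_≟_; _<?_)
open import Data.List.Base using (List; []; _∷_; foldr; length; lookup; map; tabulate)
open import Data.List.Membership.Propositional using (_∈_)
open import Data.List.Relation.Unary.All using ([]; _∷_)
open import Data.List.Relation.Unary.AllPairs using ([]; _∷_)
open import Data.List.Relation.Unary.Any using (Any; here; there)
open import Data.List.Relation.Unary.Unique.Propositional using (Unique)
open import Data.Nat.Base using (ℕ; suc; _*_; _/_)
open import Data.Nat.Combinatorics using (_C_)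
open import Data.Product.Base using (Σ-syntax; _×_; _,_)
open import Data.Sum.Base using (_⊎_; inj₁; inj₂)
open import Function.Base using (_∘′_; id)
open import Level using (0ℓ)
open import Relation.Binary.Bundles using (Setoid)
open import Relation.Binary.Core using (_Preserves_⟶_)
open import Relation.Binary.PropositionalEquality using (_≡_; refl; sym; trans)
open import Relation.Nullary using (¬_; does)

-- Throughout, [n] = {1,…,n} is represented by Fin n, so every entry, index
-- and pattern letter is shifted down by one.  A permutation π of Fin n is
-- read in one-line notation: its i-th letter is π ⟨$⟩ʳ i.

word : ∀ {n} → Permutation′ n → List (Fin n)
word π = tabulate (π ⟨$⟩ʳ_)

-- splitAfter m w cuts w before each of its entries that exceeds m and all
-- entries preceding it in w.  The first component is the part before the
-- first cut; the second lists the remaining blocks.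

splitAfter : ∀ {n} → Fin n → List (Fin n) → List (Fin n) × List (List (Fin n))
splitAfter m []      = [] , []
splitAfter m (a ∷ w) =
  if does (m <? a)
  then (let (block , blocks) = splitAfter a w in [] , (a ∷ block) ∷ blocks)
  else (let (block , blocks) = splitAfter m w in a ∷ block , blocks)

cycleForm : ∀ {n} → List (Fin n) → List (List (Fin n))
cycleForm []      = []
cycleForm (a ∷ w) = let (block , blocks) = splitAfter a w in (a ∷ block) ∷ blocks

-- 2537164 ↦ (2)(53)(7164)
_ : cycleForm {7} (1F ∷ 4F ∷ 2F ∷ 6F ∷ 0F ∷ 5F ∷ 3F ∷ [])
  ≡ (1F ∷ []) ∷ (4F ∷ 2F ∷ []) ∷ (6F ∷ 0F ∷ 5F ∷ 3F ∷ []) ∷ []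
_ = refl

-- successor z cs x is the entry following x in cs, where z follows the last
-- entry; x itself if x does not occur.

successor : ∀ {n} → Fin n → List (Fin n) → Fin n → Fin n
successor z []           x = x
successor z (c ∷ [])     x = if does (x ≟ c) then z else x
successor z (c ∷ d ∷ cs) x = if does (x ≟ c) then d else successor z (d ∷ cs) x

cycle : ∀ {n} → List (Fin n) → Fin n → Fin n
cycle []       = id
cycle (c ∷ cs) = successor c (c ∷ cs)

-- π̂ is the product of the cycles in the cycle form; they are disjoint, so
-- the order of composition is immaterial.

hat : ∀ {n} → Permutation′ n → Fin n → Fin n
hat π = foldr _∘′_ id (map cycle (cycleForm (word π)))

record ArrowPattern (k : ℕ) : Set where
  field
    ν        : List (Fin k)
    H        : List (Fin k × Fin k)   -- (b , c) is the arrow b → c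
    distinct : Unique ν
    covers   : ∀ i → i ∈ ν ⊎ Any (λ (b , c) → i ≡ b ⊎ i ≡ c) H

-- The set X = {x₁ < ⋯ < xₖ} is given by its increasing enumeration x.

Contains : ∀ {n k} → Permutation′ n → ArrowPattern k → Set
Contains {n} {k} π p =
  Σ[ x ∈ (Fin k → Fin n) ] Σ[ t ∈ (Fin (length ν) → Fin n) ]
    x Preserves _<_ ⟶ _<_ ×
    t Preserves _<_ ⟶ _<_ ×
    (∀ j → π ⟨$⟩ʳ t j ≡ x (lookup ν j)) ×
    (∀ {b c} → (b , c) ∈ H → hat π (x b) ≡ x c)
  where open ArrowPattern p

Avoids : ∀ {n k} → Permutation′ n → ArrowPattern k → Set
Avoids π p = ¬ Contains π p

-- Permutations are identified when they agree pointwise, and the avoidance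
-- proofs are ignored by the equality.

𝒮 : ∀ {k} → ℕ → ArrowPattern k → Setoid 0ℓ 0ℓ
𝒮 n p = record
  { Carrier       = Σ[ π ∈ Permutation′ n ] Avoids π p
  ; _≈_           = λ (π , _) (ρ , _) → π ≈ ρ
  ; isEquivalence = record
    { refl  = λ _ → refl
    ; sym   = λ π≈ρ i → sym (π≈ρ i)
    ; trans = λ π≈ρ ρ≈σ i → trans (π≈ρ i) (ρ≈σ i)
    }
  }

-- (23; 3→1), with letters 1, 2, 3 written 0F, 1F, 2F.
pattern-23-3→1 : ArrowPattern 3
pattern-23-3→1 = record
  { ν        = 1F ∷ 2F ∷ []
  ; H        = (2F , 0F) ∷ []
  ; distinct = ((λ ()) ∷ []) ∷ [] ∷ []
  ; covers   = λ where
      0F → inj₂ (here (inj₂ refl))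
      1F → inj₁ (here refl)
      2F → inj₁ (there (here refl))
  }

-- The division is exact.
catalan : ℕ → ℕ
catalan n = ((2 * n) C n) / suc n

{-# OPTIONS --safe #-}

-- In π̂ a letter is sent either to the next letter of the word or to the maximum of its block, so
-- π̂(x) < x exactly when x is immediately followed by a smaller letter, π̂(x).  Hence avoiding
-- (23; 3→1) means avoiding the vincular pattern 2-31.  Build such permutations by prepending
-- letters: the admissible first letters ("sites") of an avoider π of size n are the b such that no
-- adjacent pair of π steps from ≥ b to < b, and after prepending the site a the new sites are 0
-- and the b + 1 with b ≥ a a site.  Moving a cursor through the ascending list of sites (down) and
-- prepending at the cursor (up) therefore encodes the avoiders of size n by the Dyck paths with n
-- up-steps, which are counted by the ballot recurrence.

module Submission where

open import Defs
open import Data.Bool.Base using (true; false)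
open import Data.Fin.Base using (Fin; zero; suc; toℕ; fromℕ; inject₁; punchIn; _<_; _≤_)
open import Data.Fin.Induction using (<-weakInduction)
open import Data.Fin.Patterns using (0F; 1F; 2F)
open import Data.Fin.Permutation as Perm
  using (Permutation′; _⟨$⟩ʳ_; _⟨$⟩ˡ_; _≈_; insert; remove; insert-remove; inverseʳ)
open import Data.Fin.Properties as Fin using (_≟_; _<?_)
open import Data.List.Base using (List; []; _∷_; _++_; concat; foldr; map; tabulate)
open import Data.List.Membership.Propositional using (_∈_; _∉_)
open import Data.List.Membership.Propositional.Properties using (∈-++⁺ˡ; ∈-++⁺ʳ; ∈-++⁻)
open import Data.List.Relation.Unary.All as All using (All; []; _∷_)
import Data.List.Relation.Unary.All.Properties as All
open import Data.List.Relation.Unary.AllPairs using ([]; _∷_)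
open import Data.List.Relation.Unary.Any using (Any; here; there; any?)
open import Data.List.Relation.Unary.Unique.Propositional using (Unique)
open import Data.List.Relation.Unary.Unique.Propositional.Properties using (tabulate⁺)
open import Data.Nat.Base as ℕ
  using (ℕ; zero; suc; _+_; _*_; _/_; _!; _≥_; z≤n; s≤s; s≤s⁻¹)
open import Data.Nat.Combinatorics using (_C_; nCk≡n!/k![n-k]!)
open import Data.Nat.DivMod using (m*n/n≡m; /-congˡ; /-congʳ)
import Data.Nat.Properties as ℕ
open import Data.Nat.Tactic.RingSolver using (solve-∀)
open import Data.Product.Base using (∃; ∃₂; ∃-syntax; _×_; _,_; proj₁; proj₂)
open import Data.Sum.Base using (_⊎_; inj₁; inj₂)
open import Data.Sum.Function.Propositional using (_⊎-↔_)
open import Data.Unit.Base using (⊤)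
open import Data.Vec.Base as Vec using (Vec; []; _∷_; head; tail)
open import Data.Vec.Membership.Propositional using () renaming (_∈_ to _∈ᵛ_)
open import Data.Vec.Membership.Propositional.Properties using (∈-map⁺)
open import Data.Vec.Relation.Unary.All as Allᵛ using ([]; _∷_) renaming (All to Allᵛ)
import Data.Vec.Relation.Unary.All.Properties as Allᵛ
open import Data.Vec.Relation.Unary.AllPairs as AllPairs using (AllPairs; []; _∷_)
import Data.Vec.Relation.Unary.AllPairs.Properties as AllPairs
open import Data.Vec.Relation.Unary.Any using (here; there)
open import Function.Base using (_∘_; _∘′_; id)
open import Function.Bundles using (Bijection; Injection; Inverse; _↔_; mk↔ₛ′)
open import Function.Construct.Composition using (inverse)
import Function.Construct.Symmetry as Symmetry
open import Function.Properties.Bijection using (Bijection⇒Inverse)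
open import Function.Properties.Inverse using (↔⇒↣; ↔-sym; ↔-trans)
open import Relation.Binary.Definitions using (tri<; tri≈; tri>)
open import Relation.Binary.PropositionalEquality
  using (_≡_; refl; sym; trans; cong; cong₂; setoid; subst; subst₂; module ≡-Reasoning)
open import Relation.Nullary using (¬_; contradiction; no; ofʸ; ofⁿ; yes)

private variable
  A : Set
  k l n : ℕ

-- Cycles and adjacent letters

data Adjacent {A : Set} (x y : A) : List A → Set where
  here  : ∀ {w} → Adjacent x y (x ∷ y ∷ w)
  there : ∀ {a w} → Adjacent x y w → Adjacent x y (a ∷ w)

module _ {x y : A} where

  adjacent⇒∈ˡ : ∀ {w} → Adjacent x y w → x ∈ w
  adjacent⇒∈ˡ here      = here refl
  adjacent⇒∈ˡ (there p) = there (adjacent⇒∈ˡ p)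

  adjacent⇒∈ʳ : ∀ {w} → Adjacent x y w → y ∈ w
  adjacent⇒∈ʳ here      = there (here refl)
  adjacent⇒∈ʳ (there p) = there (adjacent⇒∈ʳ p)

  adjacent-++⁺ˡ : ∀ {v w} → Adjacent x y v → Adjacent x y (v ++ w)
  adjacent-++⁺ˡ here      = here
  adjacent-++⁺ˡ (there p) = there (adjacent-++⁺ˡ p)

  adjacent-++⁺ʳ : ∀ v {w} → Adjacent x y w → Adjacent x y (v ++ w)
  adjacent-++⁺ʳ []      p = p
  adjacent-++⁺ʳ (_ ∷ v) p = there (adjacent-++⁺ʳ v p)

  adjacent-concat⁺ : ∀ {vs} → Any (Adjacent x y) vs → Adjacent x y (concat vs)
  adjacent-concat⁺ (here p)          = adjacent-++⁺ˡ p
  adjacent-concat⁺ (there {x = v} p) = adjacent-++⁺ʳ v (adjacent-concat⁺ p)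

adjacent-tabulate⁺ : (f : Fin n → A) {i j : Fin n} → toℕ j ≡ suc (toℕ i) →
                     Adjacent (f i) (f j) (tabulate f)
adjacent-tabulate⁺ f {zero}  {suc zero} _ = here
adjacent-tabulate⁺ f {suc i} {suc j}    e = there (adjacent-tabulate⁺ (f ∘ suc) (ℕ.suc-injective e))

adjacent-tabulate⁻ : ∀ (f : Fin n → A) {x y} → Adjacent x y (tabulate f) →
                     ∃₂ λ i j → toℕ j ≡ suc (toℕ i) × x ≡ f i × y ≡ f j
adjacent-tabulate⁻ {n = suc (suc _)} f here = zero , suc zero , refl , refl , refl
adjacent-tabulate⁻ {n = suc _} f (there p) with adjacent-tabulate⁻ (f ∘ suc) p
... | i , j , e , x≡ , y≡ = suc i , suc j , cong suc e , x≡ , y≡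

unique-++⁻ : ∀ (v : List A) {w} → Unique (v ++ w) →
             Unique v × Unique w × (∀ {x} → x ∈ v → x ∉ w)
unique-++⁻ []      u       = [] , u , λ ()
unique-++⁻ (a ∷ v) (a∉ ∷ u) with unique-++⁻ v u
... | v! , w! , disj = All.++⁻ˡ v a∉ ∷ v! , w! , λ where
  (here refl) a∈w → All.lookup (All.++⁻ʳ v a∉) a∈w refl
  (there x∈v)     → disj x∈v

successor-∉ : ∀ {z x : Fin n} {cs} → x ∉ cs → successor z cs x ≡ x
successor-∉ {cs = []} _ = refl
successor-∉ {x = x} {c ∷ []} x∉ with x ≟ c
... | yes x≡c = contradiction (here x≡c) x∉
... | no  _   = refl
successor-∉ {z = z} {x} {c ∷ d ∷ cs} x∉ with x ≟ c | successor-∉ {z = z} {cs = d ∷ cs} (x∉ ∘ there)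
... | yes x≡c | _  = contradiction (here x≡c) x∉
... | no  _   | ih = ih

successor-∈ : ∀ {z x : Fin n} {cs} → x ∈ cs →
              successor z cs x ≡ z ⊎ Adjacent x (successor z cs x) cs
successor-∈ {x = x} {c ∷ []} (here refl) with x ≟ x
... | yes _   = inj₁ refl
... | no  x≢x = contradiction refl x≢x
successor-∈ {z = z} {x} {c ∷ d ∷ cs} x∈ with x ≟ c
... | yes refl = inj₂ here
... | no  x≢c with x∈
...   | here x≡c  = contradiction x≡c x≢c
...   | there x∈′ with successor-∈ {z = z} x∈′
...     | inj₁ e = inj₁ e
...     | inj₂ p = inj₂ (there p)

successor-adjacent : ∀ {z x y : Fin n} {cs} → Unique cs → Adjacent x y cs → successor z cs x ≡ y
successor-adjacent {x = x} _ here with x ≟ x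
... | yes _   = refl
... | no  x≢x = contradiction refl x≢x
successor-adjacent {x = x} {cs = c ∷ d ∷ cs} (c∉ ∷ u) (there p) with x ≟ c
... | yes refl = contradiction refl (All.lookup c∉ (adjacent⇒∈ˡ p))
... | no  _    = successor-adjacent u p

cycle-∉ : ∀ (b : List (Fin n)) {x} → x ∉ b → cycle b x ≡ x
cycle-∉ []      _  = refl
cycle-∉ (_ ∷ _) x∉ = successor-∉ x∉

cycle-∈ : ∀ (b : List (Fin n)) {x} → x ∈ b → cycle b x ∈ b
cycle-∈ (c ∷ cs) x∈ with successor-∈ {z = c} x∈
... | inj₁ e = here e
... | inj₂ p = adjacent⇒∈ʳ p

cycle-adjacent : ∀ {b : List (Fin n)} {x y} → Unique b → Adjacent x y b → cycle b x ≡ y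
cycle-adjacent {b = _ ∷ _} = successor-adjacent

-- Invariant of the blocks of a cycle form: each starts at a left-to-right maximum and stops before
-- the next one.
LedByMax : List (Fin n) → Set
LedByMax []       = ⊤
LedByMax (c ∷ cs) = All (_≤ c) cs

-- The only move of a cycle that does not follow the word is the wrap-around to the leader, which is
-- maximal, so that move never goes down.
cycle-descent : ∀ {b : List (Fin n)} {x} → LedByMax b → cycle b x < x → Adjacent x (cycle b x) b
cycle-descent {b = []} _ y<x = contradiction refl (Fin.<⇒≢ y<x)
cycle-descent {b = b@(c ∷ cs)} {x} led y<x with any? (x ≟_) b
... | no x∉ = contradiction (cycle-∉ b x∉) (Fin.<⇒≢ y<x)
... | yes x∈ with successor-∈ {z = c} x∈
...   | inj₂ p = p
...   | inj₁ e = contradiction (All.lookup (Fin.≤-refl {x = c} ∷ led) x∈)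
                               (ℕ.<⇒≱ (subst (_< x) e y<x))

cycles : List (List (Fin n)) → Fin n → Fin n
cycles bs = foldr _∘′_ id (map cycle bs)

cycles-∉ : ∀ (bs : List (List (Fin n))) {x} → x ∉ concat bs → cycles bs x ≡ x
cycles-∉ []       _  = refl
cycles-∉ (b ∷ bs) x∉ =
  trans (cong (cycle b) (cycles-∉ bs (x∉ ∘ ∈-++⁺ʳ b))) (cycle-∉ b (x∉ ∘ ∈-++⁺ˡ))

-- In the composite `cycle b` acts last, here on a letter of a later block, and it fixes that letter
-- because blocks are disjoint.
cycles-skip : ∀ (b : List (Fin n)) bs {x} → Unique (b ++ concat bs) →
              cycles bs x ∈ concat bs → cycles (b ∷ bs) x ≡ cycles bs x
cycles-skip b bs u y∈ = cycle-∉ b (λ y∈b → proj₂ (proj₂ (unique-++⁻ b u)) y∈b y∈)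

cycles-∈ : ∀ (bs : List (List (Fin n))) {x} → Unique (concat bs) →
           x ∈ concat bs → cycles bs x ∈ concat bs
cycles-∈ (b ∷ bs) u x∈ with unique-++⁻ b u | ∈-++⁻ b x∈
... | _ , _  , disj | inj₁ x∈b  =
  ∈-++⁺ˡ (subst (λ z → cycle b z ∈ b) (sym (cycles-∉ bs (disj x∈b))) (cycle-∈ b x∈b))
... | _ , u′ , _    | inj₂ x∈bs =
  ∈-++⁺ʳ b (subst (_∈ concat bs) (sym (cycles-skip b bs u y∈)) y∈)
  where y∈ = cycles-∈ bs u′ x∈bs

cycles-adjacent : ∀ {bs : List (List (Fin n))} {x y} → Unique (concat bs) →
                  Any (Adjacent x y) bs → cycles bs x ≡ y
cycles-adjacent {bs = b ∷ bs} u (here p) with unique-++⁻ b u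
... | b! , _ , disj =
  trans (cong (cycle b) (cycles-∉ bs (disj (adjacent⇒∈ˡ p)))) (cycle-adjacent b! p)
cycles-adjacent {bs = b ∷ bs} u (there p) with unique-++⁻ b u
... | _ , u′ , _ = trans (cycles-skip b bs u (subst (_∈ concat bs) (sym e) y∈)) e
  where
  e  = cycles-adjacent u′ p
  y∈ = adjacent⇒∈ʳ (adjacent-concat⁺ p)

cycles-descent : ∀ {bs : List (List (Fin n))} {x} → Unique (concat bs) → All LedByMax bs →
                 cycles bs x < x → Any (Adjacent x (cycles bs x)) bs
cycles-descent {bs = []} _ _ y<x = contradiction refl (Fin.<⇒≢ y<x)
cycles-descent {bs = b ∷ bs} {x} u (led ∷ leds) y<x with any? (x ≟_) (concat bs)
... | no x∉ = here (subst (λ z → Adjacent x (cycle b z) b) (sym x≡)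
                          (cycle-descent led (subst (λ z → cycle b z < x) x≡ y<x)))
  where x≡ = cycles-∉ bs x∉
... | yes x∈ = there (subst (λ z → Any (Adjacent x z) bs) (sym e)
                            (cycles-descent u′ leds (subst (_< x) e y<x)))
  where
  u′ = proj₁ (proj₂ (unique-++⁻ b u))
  e  = cycles-skip b bs u (cycles-∈ bs u′ x∈)

-- Blocks of the cycle form

splitAfter-concat : ∀ (m : Fin n) w → let (block , blocks) = splitAfter m w in
                    block ++ concat blocks ≡ w
splitAfter-concat m []      = refl
splitAfter-concat m (a ∷ w) with toℕ m ℕ.<ᵇ toℕ a | ℕ.<ᵇ-reflects-< (toℕ m) (toℕ a)
... | true  | _ = cong (a ∷_) (splitAfter-concat a w)
... | false | _ = cong (a ∷_) (splitAfter-concat m w)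

splitAfter-ledByMax : ∀ (m : Fin n) w → let (block , blocks) = splitAfter m w in
                      All (_≤ m) block × All LedByMax blocks
splitAfter-ledByMax m []      = [] , []
splitAfter-ledByMax m (a ∷ w) with toℕ m ℕ.<ᵇ toℕ a | ℕ.<ᵇ-reflects-< (toℕ m) (toℕ a)
... | true  | _       = let (led , leds) = splitAfter-ledByMax a w in [] , led ∷ leds
... | false | ofⁿ m≮a = let (led , leds) = splitAfter-ledByMax m w in ℕ.≮⇒≥ m≮a ∷ led , leds

-- A cut before `a` requires `a` to exceed the running maximum `m`, hence also the preceding letter
-- `c`: no descent is ever separated. Keeping `c` apart from `m` lets the induction move inside a
-- block.
splitAfter-descent : ∀ {x y c : Fin n} m w → let (block , blocks) = splitAfter m w in
                     y < x → c ≤ m → Adjacent x y (c ∷ w) →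
                     Any (Adjacent x y) ((c ∷ block) ∷ blocks)
splitAfter-descent m (a ∷ w) y<x c≤m here with toℕ m ℕ.<ᵇ toℕ a | ℕ.<ᵇ-reflects-< (toℕ m) (toℕ a)
... | true  | ofʸ m<a = contradiction (ℕ.<-trans m<a y<x) (ℕ.≤⇒≯ c≤m)
... | false | _       = here here
splitAfter-descent m (a ∷ w) y<x c≤m (there p) with toℕ m ℕ.<ᵇ toℕ a | ℕ.<ᵇ-reflects-< (toℕ m) (toℕ a)
... | true  | _       = there (splitAfter-descent a w y<x Fin.≤-refl p)
... | false | ofⁿ m≮a with splitAfter-descent m w y<x (ℕ.≮⇒≥ m≮a) p
...   | here q  = here (there q)
...   | there q = there q

cycleForm-concat : (w : List (Fin n)) → concat (cycleForm w) ≡ w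
cycleForm-concat []      = refl
cycleForm-concat (a ∷ w) = cong (a ∷_) (splitAfter-concat a w)

cycleForm-ledByMax : (w : List (Fin n)) → All LedByMax (cycleForm w)
cycleForm-ledByMax []      = []
cycleForm-ledByMax (a ∷ w) = let (led , leds) = splitAfter-ledByMax a w in led ∷ leds

cycleForm-descent : ∀ {x y : Fin n} w → y < x → Adjacent x y w → Any (Adjacent x y) (cycleForm w)
cycleForm-descent (a ∷ w) y<x = splitAfter-descent a w y<x Fin.≤-refl

-- Descents of π̂ and the pattern 2-31

⟨$⟩ʳ-injective : (π : Permutation′ n) → ∀ {i j} → π ⟨$⟩ʳ i ≡ π ⟨$⟩ʳ j → i ≡ j
⟨$⟩ʳ-injective π = Injection.injective (↔⇒↣ π)

cycleForm-unique : (π : Permutation′ n) → Unique (concat (cycleForm (word π)))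
cycleForm-unique π = subst Unique (sym (cycleForm-concat (word π))) (tabulate⁺ (⟨$⟩ʳ-injective π))

hat-descent⁺ : ∀ (π : Permutation′ n) {i j} → toℕ j ≡ suc (toℕ i) →
               π ⟨$⟩ʳ j < π ⟨$⟩ʳ i → hat π (π ⟨$⟩ʳ i) ≡ π ⟨$⟩ʳ j
hat-descent⁺ π j≡1+i πj<πi = cycles-adjacent (cycleForm-unique π)
  (cycleForm-descent (word π) πj<πi (adjacent-tabulate⁺ (π ⟨$⟩ʳ_) j≡1+i))

hat-descent⁻ : ∀ (π : Permutation′ n) {x} → hat π x < x →
               ∃₂ λ i j → toℕ j ≡ suc (toℕ i) × x ≡ π ⟨$⟩ʳ i × hat π x ≡ π ⟨$⟩ʳ j
hat-descent⁻ π {x} y<x = adjacent-tabulate⁻ (π ⟨$⟩ʳ_)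
  (subst (Adjacent x _) (cycleForm-concat (word π))
    (adjacent-concat⁺ (cycles-descent (cycleForm-unique π) (cycleForm-ledByMax (word π)) y<x)))

-- Letters at distinct positions differ, so this excludes exactly π j < π h < π i.
Avoids-2-31 : Permutation′ n → Set
Avoids-2-31 {n} π = ∀ (h i j : Fin n) → h < i → toℕ j ≡ suc (toℕ i) →
                    π ⟨$⟩ʳ h ≤ π ⟨$⟩ʳ i → π ⟨$⟩ʳ h ≤ π ⟨$⟩ʳ j

avoids⇒avoids-2-31 : (π : Permutation′ n) → Avoids π pattern-23-3→1 → Avoids-2-31 π
avoids⇒avoids-2-31 π av h i j h<i j≡1+i πh≤πi with π ⟨$⟩ʳ j <? π ⟨$⟩ʳ h
... | no  πj≮πh = ℕ.≮⇒≥ πj≮πh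
... | yes πj<πh = contradiction contains av
  where
  πh<πi : π ⟨$⟩ʳ h < π ⟨$⟩ʳ i
  πh<πi = Fin.≤∧≢⇒< πh≤πi (Fin.<⇒≢ h<i ∘ ⟨$⟩ʳ-injective π)
  x : Fin 3 → Fin _
  x 0F = π ⟨$⟩ʳ j
  x 1F = π ⟨$⟩ʳ h
  x 2F = π ⟨$⟩ʳ i
  t : Fin 2 → Fin _
  t 0F = h
  t 1F = i
  x-mono : ∀ {a b} → a < b → x a < x b
  x-mono {0F} {1F} _ = πj<πh
  x-mono {0F} {2F} _ = ℕ.<-trans πj<πh πh<πi
  x-mono {1F} {2F} _ = πh<πi
  x-mono {1F} {1F} (s≤s ())
  x-mono {2F} {1F} (s≤s ())
  x-mono {2F} {2F} (s≤s (s≤s ()))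
  t-mono : ∀ {a b} → a < b → t a < t b
  t-mono {0F} {1F} _ = h<i
  t-mono {1F} {1F} (s≤s ())
  entries : ∀ a → π ⟨$⟩ʳ t a ≡ _
  entries 0F = refl
  entries 1F = refl
  arrows : ∀ {b c} → (b , c) ∈ (2F , 0F) ∷ [] → hat π (x b) ≡ x c
  arrows (here refl) = hat-descent⁺ π j≡1+i (ℕ.<-trans πj<πh πh<πi)
  contains : Contains π pattern-23-3→1
  contains = x , t , (λ {a} {b} → x-mono {a} {b}) , (λ {a} {b} → t-mono {a} {b}) , entries , arrows

avoids-2-31⇒avoids : (π : Permutation′ n) → Avoids-2-31 π → Avoids π pattern-23-3→1
avoids-2-31⇒avoids π av (x , t , x-mono , t-mono , entries , arrows)
  -- The arrow sends `x 2F` to the smaller `x 0F`, so these letters are adjacent in the word and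
  -- play the 31 of a 2-31.
  with hat-descent⁻ π {x 2F} (subst (_< x 2F) (sym (arrows (here refl))) (x-mono (s≤s z≤n)))
... | i , j , j≡1+i , x₂≡πi , hat≡πj = ℕ.<⇒≱ (x-mono {0F} {1F} (s≤s z≤n))
  (subst₂ _≤_ (entries 0F) (trans (sym hat≡πj) (arrows (here refl)))
    (av (t 0F) i j (subst (t 0F <_) t₁≡i (t-mono (s≤s z≤n))) j≡1+i
      (subst₂ _≤_ (sym (entries 0F)) x₂≡πi (ℕ.<⇒≤ (x-mono {1F} {2F} (s≤s (s≤s z≤n)))))))
  where
  t₁≡i : t 1F ≡ i
  t₁≡i = ⟨$⟩ʳ-injective π (trans (entries 1F) x₂≡πi)

-- Dyck prefixes

-- `punchIn a` raises by one exactly the letters at least `a`, so a threshold `b ≥ a` moves up with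
-- them.
≤-punchIn⁺ : ∀ {a b : Fin (suc n)} {x} → a ≤ b → b ≤ x → suc b ≤ punchIn a x
≤-punchIn⁺ {a = zero}                         _   b≤x = s≤s b≤x
≤-punchIn⁺ {a = suc _} {b = suc _} {x = suc _} a≤b b≤x = s≤s (≤-punchIn⁺ (s≤s⁻¹ a≤b) (s≤s⁻¹ b≤x))

≤-punchIn⁻ : ∀ {a b : Fin (suc n)} {x} → a ≤ b → suc b ≤ punchIn a x → b ≤ x
≤-punchIn⁻ {a = zero}                         _   b≤x = s≤s⁻¹ b≤x
≤-punchIn⁻ {a = suc _} {b = suc _} {x = suc _} a≤b b≤x = s≤s (≤-punchIn⁻ (s≤s⁻¹ a≤b) (s≤s⁻¹ b≤x))

i≤punchIn⁺ : ∀ {a : Fin (suc n)} {x} → a ≤ x → a ≤ punchIn a x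
i≤punchIn⁺ {a = a} a≤x = ℕ.<⇒≤ (≤-punchIn⁺ {a = a} {b = a} ℕ.≤-refl a≤x)

i≤punchIn⁻ : ∀ {a : Fin (suc n)} {x} → a ≤ punchIn a x → a ≤ x
i≤punchIn⁻ {a = a} {x} a≤ =
  ≤-punchIn⁻ {a = a} {b = a} ℕ.≤-refl (Fin.≤∧≢⇒< a≤ (Fin.punchInᵢ≢i a x ∘ sym))

-- The values b that may be prepended to π (raising the letters ≥ b) without making b the 2 of a 2-31.
Site : Permutation′ n → Fin (suc n) → Set
Site {n} π b = ∀ (i j : Fin n) → toℕ j ≡ suc (toℕ i) → b ≤ π ⟨$⟩ʳ i → b ≤ π ⟨$⟩ʳ j

module _ (π ρ : Permutation′ n) (π≈ρ : π ≈ ρ) where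

  site-resp : ∀ {b} → Site π b → Site ρ b
  site-resp {b} s i j e = subst₂ (λ x y → b ≤ x → b ≤ y) (π≈ρ i) (π≈ρ j) (s i j e)

  avoids-resp : Avoids-2-31 π → Avoids-2-31 ρ
  avoids-resp av h i j h<i e rewrite sym (π≈ρ h) | sym (π≈ρ i) | sym (π≈ρ j) = av h i j h<i e

-- The site condition passes `b ≤` from each letter to the next, so from the first letter it reaches
-- all of them, including the letter 0.
site-below-first : ∀ (π : Permutation′ (suc n)) {b} → Site π b → b ≤ π ⟨$⟩ʳ 0F → b ≡ 0F
site-below-first π {b} s b≤π₀ =
  Fin.toℕ-injective (ℕ.n≤0⇒n≡0 (subst (b ≤_) (inverseʳ π) (all≥b (π ⟨$⟩ˡ 0F))))
  where
  all≥b : ∀ i → b ≤ π ⟨$⟩ʳ i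
  all≥b = <-weakInduction _ b≤π₀ λ i → s (inject₁ i) (suc i) (cong suc (sym (Fin.toℕ-inject₁ i)))

module _ (π : Permutation′ n) {a : Fin (suc n)} where

  site-insert⁺ : ∀ {b} → a ≤ b → Site π b → Site (insert 0F a π) (suc b)
  -- The new first letter `a` lies below the threshold `suc b`, so the pair it begins imposes
  -- nothing.
  site-insert⁺ a≤b s zero    _       _ b<a = contradiction b<a (ℕ.≤⇒≯ a≤b)
  site-insert⁺ a≤b s (suc i) (suc j) e b<x =
    ≤-punchIn⁺ a≤b (s i j (ℕ.suc-injective e) (≤-punchIn⁻ {a = a} a≤b b<x))

  site-insert⁻ : ∀ {b} → Site (insert 0F a π) (suc b) → a ≤ b × Site π b
  site-insert⁻ {b} s with a Fin.≤? b
  -- If `b < a`, then `suc b` is at most the new first letter, which only the site 0 can be.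
  ... | no  a≰b with () ← site-below-first (insert 0F a π) {suc b} s (ℕ.≰⇒> a≰b)
  ... | yes a≤b = a≤b , λ i j e b≤x →
    ≤-punchIn⁻ {a = a} a≤b (s (suc i) (suc j) (cong suc e) (≤-punchIn⁺ a≤b b≤x))

  -- The triples whose 2 is the new letter `a` express the condition `Site π a`; all others come
  -- from π.
  avoids-insert⁺ : Avoids-2-31 π → Site π a → Avoids-2-31 (insert 0F a π)
  avoids-insert⁺ av s zero    (suc i) (suc j) _         e a≤x =
    i≤punchIn⁺ (s i j (ℕ.suc-injective e) (i≤punchIn⁻ a≤x))
  avoids-insert⁺ av s (suc h) (suc i) (suc j) (s≤s h<i) e y≤x =
    Fin.punchIn-mono-≤ a _ _ (av h i j h<i (ℕ.suc-injective e) (Fin.punchIn-cancel-≤ a _ _ y≤x))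

  avoids-insert⁻ : Avoids-2-31 (insert 0F a π) → Avoids-2-31 π × Site π a
  avoids-insert⁻ av =
    (λ h i j h<i e y≤x → Fin.punchIn-cancel-≤ a _ _
      (av (suc h) (suc i) (suc j) (s≤s h<i) (cong suc e) (Fin.punchIn-mono-≤ a _ _ y≤x))) ,
    (λ i j e a≤x → i≤punchIn⁻
      (av zero (suc i) (suc j) (s≤s z≤n) (cong suc e) (i≤punchIn⁺ a≤x)))

module _ {n : ℕ} where

  Ascending : Vec (Fin n) k → Set
  Ascending = AllPairs _<_

  head-least : ∀ {xs : Vec (Fin n) (suc k)} → Ascending xs → Allᵛ (head xs ≤_) xs
  head-least (x< ∷ _) = ℕ.≤-refl ∷ Allᵛ.map ℕ.<⇒≤ x<

  head<second : ∀ {xs : Vec (Fin n) (2 + k)} → Ascending xs → head xs < head (tail xs)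
  head<second {xs = _ ∷ _ ∷ _} ((x<y ∷ _) ∷ _) = x<y

  ∈-tail : ∀ {xs : Vec (Fin n) (suc k)} {b} → b ∈ᵛ xs → head xs < b → b ∈ᵛ tail xs
  ∈-tail (here refl) x<x = contradiction x<x (ℕ.<-irrefl refl)
  ∈-tail (there b∈)  _   = b∈

-- Prefixes of Dyck paths, indexed by the number of up-steps and the final height.
data Path : ℕ → ℕ → Set where
  []   : Path 0 0
  up   : Path n k → Path (suc n) (suc k)
  down : Path n (suc k) → Path n k

height≤ups : Path n k → k ℕ.≤ n
height≤ups []       = z≤n
height≤ups (up p)   = s≤s (height≤ups p)
height≤ups (down p) = ℕ.<⇒≤ (height≤ups p)

too-high : ¬ Path n (suc n)
too-high p = ℕ.1+n≰n (height≤ups p)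

-- sites p lists the sites of perm p from a cursor (the head) upwards: an up-step inserts at the
-- cursor and resets it to 0, a down-step advances it.
sites : Path n k → Vec (Fin (suc n)) (suc k)
sites []       = zero ∷ []
sites (up p)   = zero ∷ Vec.map suc (sites p)
sites (down p) = tail (sites p)

perm : Path n k → Permutation′ n
perm []       = Perm.id
perm (up p)   = insert 0F (head (sites p)) (perm p)
perm (down p) = perm p

sites-ascending : (p : Path n k) → Ascending (sites p)
sites-ascending []       = [] ∷ []
sites-ascending (up p)   = Allᵛ.map⁺ (Allᵛ.universal (λ _ → s≤s z≤n) (sites p)) ∷
                           AllPairs.map⁺ (AllPairs.map s≤s (sites-ascending p))
sites-ascending (down p) with sites p | sites-ascending p
... | _ ∷ _ | _ ∷ asc = asc

sites-sound : (p : Path n k) → Allᵛ (Site (perm p)) (sites p)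
sites-sound []       = (λ ()) ∷ []
sites-sound (up p)   = (λ _ _ _ _ → z≤n) ∷ Allᵛ.map⁺
  (Allᵛ.map (λ (a≤b , s) → site-insert⁺ (perm p) a≤b s)
           (Allᵛ.zip (head-least (sites-ascending p) , sites-sound p)))
sites-sound (down p) with sites p | sites-sound p
... | _ ∷ _ | _ ∷ sound = sound

-- Down-steps discard the sites below the cursor, hence the bound on `b`. After an up-step,
-- `site-insert⁻` traces a positive site back to one at or above the old cursor.
sites-complete : ∀ (p : Path n k) {b} → Site (perm p) b → head (sites p) ≤ b → b ∈ᵛ sites p
sites-complete []       {zero}  _ _ = here refl
sites-complete (up p)   {zero}  _ _ = here refl
sites-complete (up p)   {suc b} s _ with site-insert⁻ (perm p) s
... | a≤b , s′ = there (∈-map⁺ suc (sites-complete p s′ a≤b))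
sites-complete (down p) {b} s a≤b = ∈-tail (sites-complete p s (ℕ.<⇒≤ a<b)) a<b
  where a<b = ℕ.<-≤-trans (head<second (sites-ascending p)) a≤b

head-sites-sound : (p : Path n k) → Site (perm p) (head (sites p))
head-sites-sound p with sites p | sites-sound p
... | _ ∷ _ | s ∷ _ = s

perm-avoids : (p : Path n k) → Avoids-2-31 (perm p)
perm-avoids []       ()
perm-avoids (up p)   = avoids-insert⁺ (perm p) (perm-avoids p) (head-sites-sound p)
perm-avoids (down p) = perm-avoids p

-- Injectivity of the encoding

no-site-between : ∀ (p : Path n (suc k)) {b} → Site (perm p) b →
                  head (sites p) < b → head (tail (sites p)) ≤ b
no-site-between p {b} s a<b = Allᵛ.lookup (head-least (sites-ascending (down p)))
  (∈-tail (sites-complete p s (ℕ.<⇒≤ a<b)) a<b)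

-- Serves to cancel a common down-step. A cursor of `q` above that of `p` would be a site of the
-- same permutation, hence at least the next site of `p`, which is also the next site of `q`; but
-- the sites of `q` ascend strictly.
second-≡⇒head-≮ : ∀ (p : Path n (suc k)) (q : Path n (suc l)) → perm p ≈ perm q →
                  head (tail (sites p)) ≡ head (tail (sites q)) → ¬ head (sites p) < head (sites q)
second-≡⇒head-≮ p q p≈q e a<a′ = ℕ.<⇒≱ (head<second (sites-ascending q))
  (subst (_≤ head (sites q)) e (no-site-between p
    (site-resp (perm q) (perm p) (λ i → sym (p≈q i)) (head-sites-sound q)) a<a′))

second-≡⇒head-≡ : ∀ (p : Path n (suc k)) (q : Path n (suc l)) → perm p ≈ perm q →
                  head (tail (sites p)) ≡ head (tail (sites q)) → head (sites p) ≡ head (sites q)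
second-≡⇒head-≡ p q p≈q e with Fin.<-cmp (head (sites p)) (head (sites q))
... | tri< lt _ _ = contradiction lt (second-≡⇒head-≮ p q p≈q e)
... | tri≈ _ eq _ = eq
... | tri> _ _ gt = contradiction gt (second-≡⇒head-≮ q p (λ i → sym (p≈q i)) (sym e))

-- The cursor reveals the last step: it is 0 after an up-step and positive after a down-step. The
-- heights are not assumed equal, so they are recovered along with the paths.
perm-injective : ∀ (p : Path n k) (q : Path n l) → perm p ≈ perm q → head (sites p) ≡ head (sites q) →
                 _≡_ {A = ∃ (Path n)} (k , p) (l , q)
perm-injective []       []       _   _ = refl
perm-injective []       (down q) _   _ with () ← height≤ups q
perm-injective (down p) []       _   _ with () ← height≤ups p
perm-injective (up p)   (up q)   p≈q _
  -- The first letters are the cursors before the up-steps, so `p≈q 0F` equates those; cancelling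
  -- `punchIn` then equates the remaining letters.
  with perm-injective p q
         (λ i → Fin.punchIn-injective (head (sites p)) _ _
           (trans (p≈q (suc i)) (cong (λ a → punchIn a (perm q ⟨$⟩ʳ i)) (sym (p≈q 0F)))))
         (p≈q 0F)
... | refl = refl
perm-injective (up p)   (down q) _   e = contradiction (head<second (sites-ascending q))
  (subst (λ a → ¬ head (sites q) < a) e λ ())
perm-injective (down p) (up q)   _   e = contradiction (head<second (sites-ascending p))
  (subst (λ a → ¬ head (sites p) < a) (sym e) λ ())
perm-injective (down p) (down q) p≈q e
  with perm-injective p q p≈q (second-≡⇒head-≡ p q p≈q e)
... | refl = refl

-- Surjectivity of the encoding

site-top : (π : Permutation′ n) → Site π (fromℕ n)
site-top {n} π i _ _ n≤x =
  contradiction (Fin.toℕ<n (π ⟨$⟩ʳ i)) (ℕ.≤⇒≯ (subst (ℕ._≤ toℕ (π ⟨$⟩ʳ i)) (Fin.toℕ-fromℕ n) n≤x))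

-- At height 0 only the cursor is left in the list, and the top value is always a site.
ground-head : (p : Path n 0) → head (sites p) ≡ fromℕ n
ground-head p with sites p | sites-complete p (site-top (perm p)) (Fin.≤fromℕ _)
... | _ ∷ [] | here eq = sym eq

-- Down-steps bring the cursor to any listed site without changing the permutation. The list is a
-- separate `xs` so that the recursion can match on it.
advance : ∀ (p : Path n k) {xs} → sites p ≡ xs → ∀ {b} → b ∈ᵛ xs →
          ∃₂ λ l (q : Path n l) → perm q ≡ perm p × head (sites q) ≡ b
advance p {_ ∷ _}     e (here b≡x) = _ , p , refl , trans (cong head e) (sym b≡x)
advance p {_ ∷ _ ∷ _} e (there b∈) = advance (down p) (cong tail e) b∈

perm-up-≈ : ∀ (π : Permutation′ (suc n)) (p : Path n k) → perm p ≈ remove 0F π →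
            head (sites p) ≡ π ⟨$⟩ʳ 0F → perm (up p) ≈ π
perm-up-≈ π p p≈ e 0F      = e
perm-up-≈ π p p≈ e (suc i) =
  trans (cong₂ punchIn e (p≈ i)) (insert-remove 0F π (suc i))

-- Induction on removing the first letter. The cursor `b` is arbitrary because the path for the
-- remainder must stop exactly at that letter before the up-step.
perm-surjective : ∀ (π : Permutation′ n) {b} → Avoids-2-31 π → Site π b →
                  ∃₂ λ k (p : Path n k) → perm p ≈ π × head (sites p) ≡ b
perm-surjective {zero}  π {0F} _  _ = 0 , [] , (λ ()) , refl
perm-surjective {suc n} π      av s =
  let π′ = remove 0F π
      π⁺ = insert 0F (π ⟨$⟩ʳ 0F) π′
      av′ , s′ = avoids-insert⁻ π′ (avoids-resp π π⁺ (λ i → sym (insert-remove 0F π i)) av)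
      _ , p , p≈π′ , head≡ = perm-surjective π′ av′ s′
      up≈π = perm-up-≈ π p p≈π′ head≡
      -- The up-step has reset the cursor to 0, so every site of π is still ahead.
      b∈ = sites-complete (up p) (site-resp π (perm (up p)) (λ i → sym (up≈π i)) s) z≤n
      k , q , q≡up , head≡b = advance (up p) refl b∈
  in k , q , subst (_≈ π) (sym q≡up) up≈π , head≡b

path-bijection : ∀ n → Bijection (setoid (Path n 0)) (𝒮 n pattern-23-3→1)
path-bijection n = record
  { to        = λ p → perm p , avoids-2-31⇒avoids (perm p) (perm-avoids p)
  ; cong      = λ { refl _ → refl }
  ; bijective = injective , λ (π , av) → surjective π av
  }
  where
  injective : ∀ {p q : Path n 0} → perm p ≈ perm q → p ≡ q
  injective {p} {q} p≈q
    with refl ← perm-injective p q p≈q (trans (ground-head p) (sym (ground-head q))) = refl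
  surjective : ∀ π → Avoids π pattern-23-3→1 →
               ∃[ p ] (∀ {q : Path n 0} → q ≡ p → perm q ≈ π)
  surjective π av with perm-surjective π (avoids⇒avoids-2-31 π av) (site-top π)
  ... | zero  , p , p≈π , _ = p , λ { refl → p≈π }
  -- A positive height would leave another site above the cursor, which already has the top value.
  ... | suc _ , p , _   , e = contradiction (head<second (sites-ascending p))
    (ℕ.≤⇒≯ (subst (head (tail (sites p)) ≤_) (sym e) (Fin.≤fromℕ _)))

-- Ballot numbers

-- The number of Dyck prefixes with d down-steps and final height k.
ballot : ℕ → ℕ → ℕ
ballot zero    k       = 1
ballot (suc d) zero    = ballot d 1
ballot (suc d) (suc k) = ballot (suc d) k + ballot d (2 + k)

path-0-0 : Path 0 0 ↔ Fin 1
path-0-0 = mk↔ₛ′ (λ _ → 0F) (λ _ → []) (λ { 0F → refl ; (suc ()) })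
  (λ { [] → refl ; (down p) → contradiction p too-high })

-- A final down-step would start from a height exceeding the number of up-steps.
path-top : Path (suc n) (suc n) ↔ Path n n
path-top = mk↔ₛ′ to up (λ _ → refl)
  (λ { (up p) → refl ; (down p) → contradiction p too-high })
  where
  to : Path (suc n) (suc n) → Path n n
  to (up p)   = p
  to (down p) = contradiction p too-high

path-ground : Path (suc n) 0 ↔ Path (suc n) 1
path-ground = mk↔ₛ′ (λ { (down p) → p }) down (λ _ → refl) (λ { (down p) → refl })

path-split : Path (suc n) (suc k) ↔ (Path n k ⊎ Path (suc n) (2 + k))
path-split = mk↔ₛ′ to from (λ { (inj₁ _) → refl ; (inj₂ _) → refl })
  (λ { (up _) → refl ; (down _) → refl })
  where
  to : Path (suc n) (suc k) → Path n k ⊎ Path (suc n) (2 + k)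
  to (up p)   = inj₁ p
  to (down p) = inj₂ p
  from : Path n k ⊎ Path (suc n) (2 + k) → Path (suc n) (suc k)
  from (inj₁ p) = up p
  from (inj₂ p) = down p

-- Removing the last step mirrors the recurrence of `ballot`: an up-step lowers `k`, a down-step
-- lowers `d` and raises `k`. The equation is a hypothesis since the sums match only up to `+-suc`.
path↔ballot : ∀ d k → n ≡ d + k → Path n k ↔ Fin (ballot d k)
path↔ballot zero    zero    refl = path-0-0
path↔ballot zero    (suc k) refl = ↔-trans path-top (path↔ballot zero k refl)
path↔ballot (suc d) zero    refl = ↔-trans path-ground (path↔ballot d 1 (sym (ℕ.+-suc d 0)))
path↔ballot (suc d) (suc k) refl = ↔-trans path-split (↔-trans
  (path↔ballot (suc d) k (ℕ.+-suc d k) ⊎-↔ path↔ballot d (2 + k) (sym (ℕ.+-suc d (suc k))))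
  (↔-sym Fin.+↔⊎))

-- ballot d k = (k + 1) (2d + k)! / (d! (d + k + 1)!), cleared of denominators.
ballot-! : ∀ d k → ballot d k * (d ! * suc (d + k) !) ≡ suc k * (d + (d + k)) !
ballot-! zero    k       = trans (ℕ.*-identityˡ _) (ℕ.*-identityˡ _)
ballot-! (suc d) zero    = begin
  ballot d 1 * ((suc d * d !) * suc (suc (d + 0)) !)
    ≡⟨ cong (λ e → ballot d 1 * ((suc d * d !) * suc e !)) (ℕ.+-suc d 0) ⟨
  ballot d 1 * ((suc d * d !) * suc (d + 1) !)
    ≡⟨ regroup (ballot d 1) d (d !) (suc (d + 1) !) ⟩
  suc d * (ballot d 1 * (d ! * suc (d + 1) !))
    ≡⟨ cong (suc d *_) (ballot-! d 1) ⟩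
  suc d * (2 * (d + (d + 1)) !)
    -- The factor `2 * suc d` is exactly the next one of the factorial.
    ≡⟨ double d ((d + (d + 1)) !) ⟩
  1 * (suc (d + (d + 1)) * (d + (d + 1)) !)
    ≡⟨ cong (λ e → 1 * suc (d + e) !) (ℕ.+-suc d 0) ⟩
  1 * suc (d + suc (d + 0)) ! ∎
  where
  open ≡-Reasoning
  regroup : ∀ b d f g → b * ((suc d * f) * g) ≡ suc d * (b * (f * g))
  regroup = solve-∀
  double : ∀ d f → suc d * (2 * f) ≡ 1 * (suc (d + (d + 1)) * f)
  double = solve-∀
ballot-! (suc d) (suc k) = begin
  (b₁ + b₂) * ((suc d * d !) * suc (suc d + suc k) !)
    ≡⟨ cong (λ e → (b₁ + b₂) * ((suc d * d !) * suc (suc e) !)) (ℕ.+-suc d k) ⟩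
  (b₁ + b₂) * ((suc d * d !) * (suc (2 + d + k) * (2 + d + k) !))
    -- Each summand sheds the factor that its induction hypothesis lacks: `3 + d + k` for `b₁`,
    -- `suc d` for `b₂`.
    ≡⟨ expand b₁ b₂ d k (d !) ((2 + d + k) !) ⟩
  (3 + d + k) * (b₁ * ((suc d * d !) * (2 + d + k) !)) +
  suc d * (b₂ * (d ! * (3 + d + k) !))
    ≡⟨ cong₂ (λ s t → (3 + d + k) * s + suc d * t) (ballot-! (suc d) k)
             (trans (cong (λ e → b₂ * (d ! * suc e !)) (sym d+2+k)) (ballot-! d (2 + k))) ⟩
  (3 + d + k) * (suc k * (suc d + (suc d + k)) !) + suc d * ((3 + k) * (d + (d + (2 + k))) !)
    ≡⟨ cong₂ (λ s t → (3 + d + k) * (suc k * s !) + suc d * ((3 + k) * t !)) (M₁ d k) (M₂ d k) ⟩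
  (3 + d + k) * (suc k * M !) + suc d * ((3 + k) * M !)
    -- The identity behind the recurrence: (d + k + 3)(k + 1) + (d + 1)(k + 3) = (k + 2)(2d + k +
    -- 3).
    ≡⟨ collect d k (M !) ⟩
  (2 + k) * (suc M * M !)
    ≡⟨ cong (λ e → (2 + k) * e !) (M₃ d k) ⟩
  (2 + k) * (suc d + (suc d + suc k)) ! ∎
  where
  open ≡-Reasoning
  b₁ = ballot (suc d) k
  b₂ = ballot d (2 + k)
  M  = 2 + (d + d + k)
  d+2+k : d + (2 + k) ≡ 2 + d + k
  d+2+k = trans (ℕ.+-suc d (suc k)) (cong suc (ℕ.+-suc d k))
  M₁ : ∀ d k → suc d + (suc d + k) ≡ 2 + (d + d + k)
  M₁ = solve-∀
  M₂ : ∀ d k → d + (d + (2 + k)) ≡ 2 + (d + d + k)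
  M₂ = solve-∀
  M₃ : ∀ d k → 3 + (d + d + k) ≡ suc d + (suc d + suc k)
  M₃ = solve-∀
  expand : ∀ b₁ b₂ d k f g → (b₁ + b₂) * ((suc d * f) * ((3 + d + k) * g)) ≡
           (3 + d + k) * (b₁ * ((suc d * f) * g)) + suc d * (b₂ * (f * ((3 + d + k) * g)))
  expand = solve-∀
  collect : ∀ d k f → (3 + d + k) * (suc k * f) + suc d * ((3 + k) * f) ≡
            (2 + k) * ((3 + (d + d + k)) * f)
  collect = solve-∀

-- At `k = 0` the factorial formula makes the central binomial coefficient equal to
-- `ballot n 0 * suc n`, so dividing by `suc n` is exact.
ballot≡catalan : ∀ n → ballot n 0 ≡ catalan n
ballot≡catalan n = sym (trans (/-congˡ {o = suc n} 2nCn) (m*n/n≡m (ballot n 0) (suc n)))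
  where
  open ≡-Reasoning
  instance
    _ = n ℕ.!* n !≢0
    _ = n ℕ.!* (2 * n ℕ.∸ n) !≢0
  regroup : ∀ b n f → b * suc n * (f * f) ≡ b * (f * (suc n * f))
  regroup = solve-∀
  2n! : (2 * n) ! ≡ ballot n 0 * suc n * (n ! * n !)
  2n! = begin
    (2 * n) !                             ≡⟨ cong (λ e → (n + e) !) (ℕ.+-identityʳ n) ⟩
    (n + n) !                             ≡⟨ cong (λ e → (n + e) !) (ℕ.+-identityʳ n) ⟨
    (n + (n + 0)) !                       ≡⟨ ℕ.*-identityˡ _ ⟨
    1 * (n + (n + 0)) !                   ≡⟨ ballot-! n 0 ⟨
    ballot n 0 * (n ! * suc (n + 0) !)    ≡⟨ cong (λ e → ballot n 0 * (n ! * suc e !)) (ℕ.+-identityʳ n) ⟩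
    ballot n 0 * (n ! * suc n !)          ≡⟨ regroup (ballot n 0) n (n !) ⟨
    ballot n 0 * suc n * (n ! * n !)      ∎
  2n∸n : 2 * n ℕ.∸ n ≡ n
  2n∸n = trans (ℕ.m+n∸m≡n n (n + 0)) (ℕ.+-identityʳ n)
  2nCn : (2 * n) C n ≡ ballot n 0 * suc n
  2nCn = begin
    (2 * n) C n                                    ≡⟨ nCk≡n!/k![n-k]! (ℕ.m≤m+n n (n + 0)) ⟩
    (2 * n) ! / (n ! * (2 * n ℕ.∸ n) !)            ≡⟨ /-congʳ (cong (λ e → n ! * e !) 2n∸n) ⟩
    (2 * n) ! / (n ! * n !)                        ≡⟨ /-congˡ 2n! ⟩
    ballot n 0 * suc n * (n ! * n !) / (n ! * n !) ≡⟨ m*n/n≡m (ballot n 0 * suc n) (n ! * n !) ⟩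
    ballot n 0 * suc n                             ∎

theorem5p3 : (n : ℕ) → n ≥ 1 → Inverse (𝒮 n pattern-23-3→1) (setoid (Fin (catalan n)))
theorem5p3 n _ = inverse
  (Symmetry.inverse (Bijection⇒Inverse (path-bijection n)))
  (subst (λ c → Path n 0 ↔ Fin c) (ballot≡catalan n) (path↔ballot n 0 (sym (ℕ.+-identityʳ n))))
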